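{- Let $k$ be an odd positive integer. For even $n>k$ let $\Psi_{n,k}$ be the CNF $\{v_1\leftrightarrow v_2,\ v_3\leftrightarrow v_4,\ \ldots,\ v_{n-1}\leftrightarrow v_n\}$ in variables $v_1,\ldots,v_n$, where $v_i\leftrightarrow v_{i+1}$ abbreviates the two clauses $(v_i\vee\neg v_{i+1})$ and $(v_{i+1}\vee\neg v_i)$. Let $\Psi'_{n,k}$ be the CNF with additional variables $r_{v_i,j}$ ($i\in[n]$, $j\in[k]$) and $s_{v_i,j}$ ($i\in[n]$, $j\in[n-k]$), whose clauses are those of $\Psi_{n,k}$ together with $$\neg v_i\vee\bigvee_{l=1}^{k} r_{v_i,l}\quad(i\in[n]),\qquad \neg v_i\vee\neg r_{v_i,j}\vee\neg r_{v_l,j}\quad(i\neq l\in[n],\ j\in[k]),$$ $$v_i\vee\bigvee_{l=1}^{n-k} s_{v_i,l}\quad(i\in[n]),\qquad v_i\vee\neg s_{v_i,j}\vee\neg s_{v_l,j}\quad(i\neq l\in[n],\ j\in[n-k]).$$ Then there exist no function $f:\mathbb{N}\to\mathbb{N}$ and positive integer $c$ such that, for every even $n>k$, $\Psi'_{n,k}$ has a Resolution refutation of size at most $f(k)\cdot n^{c}$.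
   Context: $[n]:=\{1,\ldots,n\}$. Resolution is a refutation system for unsatisfiable CNFs, operating on clauses. Its rules are: the resolution rule (from $P\vee x$ and $Q\vee\neg x$ derive $P\vee Q$, where $P,Q$ are disjunctions of literals) and weakening (from $P$ derive $P\vee l$ for a literal $l$). A refutation is a DAG whose sources are labelled by initial clauses, whose internal nodes are labelled by clauses derived from their predecessors by one of these rules, and whose unique sink is labelled by the empty clause. The size of a refutation is the number of nodes of this DAG. -}

module Defs where

open import Data.Fin using (Fin; zero; suc; _≟_)
open import Data.List using (List; []; _∷_; _++_; map; concatMap; filter; allFin)
open import Data.List.Membership.Propositional using (_∈_)
open import Data.List.Relation.Binary.BagAndSetEquality using (_∼[_]_; set)
open import Data.Nat using (ℕ; zero; suc; _∸_)
open import Data.Product using (_×_; _,_)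
import Data.Product as Product
open import Relation.Binary.Construct.Closure.Transitive using (TransClosure)
open import Relation.Binary.PropositionalEquality using (_≡_)
open import Relation.Nullary using (¬_; ¬?)

data Literal (X : Set) : Set where
  pos neg : X → Literal X

-- A clause is a disjunction of literals, considered up to order and
-- repetition: two clauses are identified by _≈_ if they have the same
-- literals.
Clause : Set → Set
Clause X = List (Literal X)

CNF : Set → Set
CNF X = List (Clause X)

infix 4 _≈_

_≈_ : {X : Set} → Clause X → Clause X → Set
C ≈ D = C ∼[ set ] D

-- How the clause E labelling a node is obtained in a graph with N nodes.
data Inference {X : Set} (φ : CNF X) {N : ℕ} (label : Fin N → Clause X)
               (E : Clause X) : Set where
  initial    : (C : Clause X) → C ∈ φ → E ≈ C → Inference φ label E
  resolution : (a b : Fin N) (P Q : Clause X) (x : X) →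
               label a ≈ P ++ pos x ∷ [] →
               label b ≈ Q ++ neg x ∷ [] →
               E ≈ P ++ Q →
               Inference φ label E
  weakening  : (a : Fin N) (P : Clause X) (l : Literal X) →
               label a ≈ P →
               E ≈ P ++ l ∷ [] →
               Inference φ label E

predecessors : {X : Set} {φ : CNF X} {N : ℕ} {label : Fin N → Clause X}
               {E : Clause X} → Inference φ label E → List (Fin N)
predecessors (initial _ _ _)              = []
predecessors (resolution a b _ _ _ _ _ _) = a ∷ b ∷ []
predecessors (weakening a _ _ _ _)        = a ∷ []

record Refutation {X : Set} (φ : CNF X) : Set where
  field
    size      : ℕ
    label     : Fin size → Clause X
    inference : (u : Fin size) → Inference φ label (label u)

  Edge : Fin size → Fin size → Set
  Edge u w = u ∈ predecessors (inference w)

  IsSink : Fin size → Set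
  IsSink u = ∀ w → ¬ Edge u w

  field
    acyclic    : ∀ u → ¬ TransClosure Edge u u
    sink       : Fin size
    isSink     : IsSink sink
    uniqueSink : ∀ u → IsSink u → u ≡ sink
    sinkEmpty  : label sink ≈ []

data Var (n k : ℕ) : Set where
  v : Fin n → Var n k
  r : Fin n → Fin k → Var n k
  s : Fin n → Fin (n ∸ k) → Var n k

-- (v₁ , v₂), (v₃ , v₄), …; for odd n the last index is left unpaired.
pairs : (n : ℕ) → List (Fin n × Fin n)
pairs zero          = []
pairs (suc zero)    = []
pairs (suc (suc n)) =
  (zero , suc zero) ∷
  map (Product.map (λ i → suc (suc i)) (λ i → suc (suc i))) (pairs n)

Ψ : (n k : ℕ) → CNF (Var n k)
Ψ n k = concatMap
  (λ (i , j) → (pos (v i) ∷ neg (v j) ∷ []) ∷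
               (pos (v j) ∷ neg (v i) ∷ []) ∷ [])
  (pairs n)

others : {n : ℕ} → Fin n → List (Fin n)
others {n} i = filter (λ l → ¬? (i ≟ l)) (allFin n)

Ψ′ : (n k : ℕ) → CNF (Var n k)
Ψ′ n k =
  Ψ n k
  ++ map (λ i → neg (v i) ∷ map (λ l → pos (r i l)) (allFin k)) (allFin n)
  ++ concatMap (λ i → concatMap (λ l → map
       (λ j → neg (v i) ∷ neg (r i j) ∷ neg (r l j) ∷ [])
       (allFin k)) (others i)) (allFin n)
  ++ map (λ i → pos (v i) ∷ map (λ l → pos (s i l)) (allFin (n ∸ k))) (allFin n)
  ++ concatMap (λ i → concatMap (λ l → map
       (λ j → pos (v i) ∷ neg (s i j) ∷ neg (s l j) ∷ [])
       (allFin (n ∸ k))) (others i)) (allFin n)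

{-# OPTIONS --safe #-}
-- Setting the first k − 1 variables v to true and the others to false turns
-- Ψ′ into the pigeonhole principle with n − k + 1 pigeons and n − k holes: this
-- assignment respects the equivalences because k − 1 is even.  The lower bound
-- for the pigeonhole principle is the argument of Beame and Pitassi.  A
-- refutation is evaluated only at the critical assignments, which fill all
-- holes and leave one pigeon out.  With 6q pigeons, call a clause large if at
-- least q² single placements of a pigeon in a hole make it true.  Some
-- placement satisfies at least 1/36 of the large clauses, so a refutation of
-- size less than (36/35)^(3q) has no large clause left after 3q placements.
-- But for a clause falsified by critical assignments for between q and 2q
-- choices of the missing pigeon, among the remaining 3q, exchanging missing
-- pigeons shows that the clause is large; and such a clause occurs on the way
-- from the initial clauses (at most one choice) to the empty clause (all 3q).
module Submission where

open import Defs
open import Algebra.Properties.Semiring.Sum using ()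
open import Data.Bool using (Bool; true; false; _∧_; not)
open import Data.Bool.Properties using (T-≡)
open import Data.Empty using (⊥)
open import Data.Fin using (Fin; zero; suc; toℕ; fromℕ<; cast; _↑ʳ_; punchIn; punchOut; _≟_)
open import Data.Fin.Induction using (spo-wellFounded)
open import Data.Fin.Permutation using (Permutation; Permutation′; _⟨$⟩ʳ_; _⟨$⟩ˡ_; insert; insert-punchIn; transpose; _∘ₚ_; inverseʳ)
open import Data.Fin.Properties using (punchIn-injective; punchIn-punchOut; sequence; toℕ-injective; toℕ-fromℕ<; toℕ-cast; toℕ-↑ʳ; toℕ<n)
import Data.Fin.Properties as Fin
open import Data.List using ([]; _∷_; _++_; map; concatMap; allFin)
open import Data.List.Membership.Propositional using (_∈_; find; lose)
open import Data.List.Membership.Propositional.Properties using (∈-++⁺ˡ; ∈-++⁺ʳ; ∈-++⁻; ∈-map⁺; ∈-map⁻; ∈-filter⁻; ∈-concatMap⁻; ∈-allFin)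
open import Data.List.Relation.Unary.Any using (Any; here; there; any?)
open import Data.Nat using (ℕ; zero; suc; _+_; _*_; _^_; _∸_; _≤_; _<_; _≤ᵇ_; z≤n; s≤s; _≤?_; _<?_; NonZero; >-nonZero)
import Data.Nat as ℕ
open import Data.Nat.Divisibility using (_∣_; _∤_; divides; _∣0; ∣m∣n⇒∣m+n; ∣-refl)
open import Data.Nat.Properties hiding (_≟_)
open import Data.Nat.Tactic.RingSolver using (solve-∀)
open import Data.Product using (Σ-syntax; ∃; ∃₂; _×_; _,_; proj₁; proj₂)
open import Data.Sum using (_⊎_; inj₁; inj₂)
import Data.Sum as Sum
open import Data.Unit using (tt)
open import Effect.Monad using (RawMonad)
open import Function using (_∘_; id; Equivalence)
open import Function.Construct.Symmetry using (⇔-sym)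
open import Induction.WellFounded using (WellFounded; Acc; acc)
open import Relation.Binary.Construct.Closure.Transitive using (TransClosure; [_]; transitive)
open import Relation.Binary.PropositionalEquality using (_≡_; _≢_; refl; sym; trans; cong; cong₂; subst; isEquivalence; resp₂; module ≡-Reasoning)
open import Relation.Nullary using (¬_; Dec; yes; no; does; ¬?; contradiction)
open import Relation.Nullary.Decidable using (dec-true; dec-false; _×-dec_; ¬¬-excluded-middle)
open import Relation.Nullary.Negation using (¬¬-Monad)
open Algebra.Properties.Semiring.Sum +-*-semiring using (sum; sum-syntax; sum-cong-≗; sum-replicate-zero; sum-remove; sum-permute; ∑-comm; ∑-distrib-+; *-distribˡ-sum; *-distribʳ-sum)

-- Finite sums, averaging and permutations.

indicator : Bool → ℕ
indicator false = 0
indicator true  = 1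

sum-mono-≤ : ∀ {n} {f g : Fin n → ℕ} → (∀ i → f i ≤ g i) → sum f ≤ sum g
sum-mono-≤ {zero}  f≤g = z≤n
sum-mono-≤ {suc n} f≤g = +-mono-≤ (f≤g zero) (sum-mono-≤ (f≤g ∘ suc))

sum-zero : ∀ {n} {f : Fin n → ℕ} → (∀ i → f i ≡ 0) → sum f ≡ 0
sum-zero {n} f≡0 = trans (sum-cong-≗ f≡0) (sum-replicate-zero n)

sum-one : ∀ n → ∑[ i < n ] 1 ≡ n
sum-one zero    = refl
sum-one (suc n) = cong suc (sum-one n)

sum-punchIn-≤ : ∀ {n} (f : Fin (suc n) → ℕ) i → sum (f ∘ punchIn i) ≤ sum f
sum-punchIn-≤ f i = ≤-trans (m≤n+m _ (f i)) (≤-reflexive (sym (sum-remove {i = i} f)))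

sum-indicator-≤1 : ∀ {n} (b : Fin n → Bool) →
  (∀ i j → b i ≡ true → b j ≡ true → i ≡ j) → sum (indicator ∘ b) ≤ 1
sum-indicator-≤1 {zero}  b unique = z≤n
sum-indicator-≤1 {suc n} b unique with b zero in b₀
... | false = sum-indicator-≤1 (b ∘ suc) λ i j bᵢ bⱼ → Fin.suc-injective (unique _ _ bᵢ bⱼ)
... | true  = s≤s (≤-reflexive (sum-zero others-zero))
  where
  others-zero : ∀ i → indicator (b (suc i)) ≡ 0
  others-zero i with b (suc i) in bᵢ
  ... | false = refl
  ... | true with () ← unique zero (suc i) b₀ bᵢ

above-average : ∀ {n} (f : Fin (suc n) → ℕ) → ∃ λ i → sum f ≤ suc n * f i
above-average {zero}  f = zero , ≤-refl
above-average {suc n} f with above-average (f ∘ suc)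
... | i , avg with f zero ≤? f (suc i)
...   | yes f₀≤fᵢ = suc i , +-mono-≤ f₀≤fᵢ avg
...   | no  f₀≰fᵢ = zero , +-monoʳ-≤ (f zero) (≤-trans avg (*-monoʳ-≤ (suc n) (≰⇒≥ f₀≰fᵢ)))

insert-self : ∀ {m n} i j (π : Permutation m n) → insert i j π ⟨$⟩ʳ i ≡ j
insert-self i j π with i ≟ i
... | yes _   = refl
... | no  i≢i = contradiction refl i≢i

punchIn-cases : ∀ {n} (i j : Fin (suc n)) → j ≡ i ⊎ ∃ λ k → j ≡ punchIn i k
punchIn-cases i j with i ≟ j
... | yes i≡j = inj₁ (sym i≡j)
... | no  i≢j = inj₂ (punchOut i≢j , sym (punchIn-punchOut i≢j))

≤ᵇ-true : ∀ {m n} → m ≤ n → (m ≤ᵇ n) ≡ true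
≤ᵇ-true m≤n = T-≡ .Equivalence.to (≤⇒≤ᵇ m≤n)

≤ᵇ-true⁻¹ : ∀ m n → (m ≤ᵇ n) ≡ true → m ≤ n
≤ᵇ-true⁻¹ m n eq = ≤ᵇ⇒≤ m n (T-≡ .Equivalence.from eq)

-- Abstract derivations and their restrictions.

-- A critical assignment sends N + 1 pigeons to N holes and leaves one pigeon
-- out.  It is encoded as a permutation π: hole h holds pigeon π (suc h), and
-- π zero is the pigeon left out.  Clauses are seen through their monotone
-- form: forced u p h says that u is true as soon as hole h holds pigeon p, and
-- alive u fails once a restriction has satisfied u.
record Derivation (N S : ℕ) : Set₁ where
  infix 4 _≺_
  field
    alive     : Fin S → Bool
    forced    : Fin S → Fin (suc N) → Fin N → Bool
    Falsifies : Permutation′ (suc N) → Fin S → Set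
    falsified⇒alive    : ∀ {π u} → Falsifies π u → alive u ≡ true
    falsified⇒unforced : ∀ {π u} → Falsifies π u → ∀ h →
                         forced u (π ⟨$⟩ʳ suc h) h ≡ false
    falsifies-update   : ∀ {π π₁ u} → Falsifies π u →
                         (∀ h → π₁ ⟨$⟩ʳ suc h ≡ π ⟨$⟩ʳ suc h ⊎
                                forced u (π₁ ⟨$⟩ʳ suc h) h ≡ false) →
                         Falsifies π₁ u
    _≺_           : Fin S → Fin S → Set
    ≺-wellFounded : WellFounded _≺_
    -- The first case serves initial clauses, the second resolution and, with `a` equal to `b`,
    -- weakening.
    inference     : ∀ u →
      (∀ {π π₁} → Falsifies π u → Falsifies π₁ u → π ⟨$⟩ʳ zero ≡ π₁ ⟨$⟩ʳ zero) ⊎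
      (∃₂ λ a b → a ≺ u × b ≺ u × ∀ {π} → Falsifies π u → Falsifies π a ⊎ Falsifies π b)
    sink           : Fin S
    sink-falsified : ∀ π → Falsifies π sink

  weight : Fin S → ℕ
  weight u = ∑[ p < suc N ] ∑[ h < N ] indicator (forced u p h)

  large : ℕ → Fin S → Bool
  large w u = alive u ∧ (w ≤ᵇ weight u)

  #large : ℕ → ℕ
  #large w = ∑[ u < S ] indicator (large w u)

open Derivation

-- Pigeon `p` and hole `h` are removed, and falsification is pulled back along the extension that
-- puts `p` into `h`. The graph is kept: satisfied clauses are only marked as not alive. Since
-- `punchIn (suc h) zero` is `zero`, the extension leaves out the same pigeon.
restrict : ∀ {N S} → Derivation (suc N) S → Fin (suc (suc N)) → Fin (suc N) → Derivation N S
restrict {N} d p h = record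
  { alive     = λ u → alive d u ∧ not (forced d u p h)
  ; forced    = λ u p′ h′ → forced d u (punchIn p p′) (punchIn h h′)
  ; Falsifies = λ π → Falsifies d (extend π)
  ; falsified⇒alive    = λ {π} {u} fals → cong₂ (λ b c → b ∧ not c) (falsified⇒alive d fals)
      (subst (λ i → forced d u i h ≡ false) (insert-self (suc h) p π)
        (falsified⇒unforced d fals h))
  ; falsified⇒unforced = λ {π} {u} fals h′ →
      subst (λ i → forced d u i (punchIn h h′) ≡ false) (extend-punchIn π (suc h′))
        (falsified⇒unforced d fals (punchIn h h′))
  ; falsifies-update   = λ {π} {π₁} fals same → falsifies-update d fals (update π π₁ same)
  ; _≺_           = _≺_ d
  ; ≺-wellFounded = ≺-wellFounded d
  ; inference     = λ u → Sum.map
      (λ unique {π} {π₁} fals fals₁ → punchIn-injective p _ _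
        (trans (sym (extend-punchIn π zero)) (trans (unique fals fals₁) (extend-punchIn π₁ zero))))
      (λ (a , b , a≺u , b≺u , step) → a , b , a≺u , b≺u , λ fals → step fals)
      (inference d u)
  ; sink           = sink d
  ; sink-falsified = λ π → sink-falsified d (extend π)
  }
  where
  extend : Permutation′ (suc N) → Permutation′ (suc (suc N))
  extend = insert (suc h) p

  extend-punchIn : ∀ π i → extend π ⟨$⟩ʳ punchIn (suc h) i ≡ punchIn p (π ⟨$⟩ʳ i)
  extend-punchIn = insert-punchIn (suc h) p

  update : ∀ π π₁ {u} →
    (∀ x → π₁ ⟨$⟩ʳ suc x ≡ π ⟨$⟩ʳ suc x ⊎
           forced d u (punchIn p (π₁ ⟨$⟩ʳ suc x)) (punchIn h x) ≡ false) →
    ∀ x → extend π₁ ⟨$⟩ʳ suc x ≡ extend π ⟨$⟩ʳ suc x ⊎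
          forced d u (extend π₁ ⟨$⟩ʳ suc x) x ≡ false
  update π π₁ {u} same x with punchIn-cases h x
  ... | inj₁ refl = inj₁ (trans (insert-self (suc h) p π₁) (sym (insert-self (suc h) p π)))
  ... | inj₂ (y , refl) = Sum.map
    (λ eq → trans (extend-punchIn π₁ (suc y))
                  (trans (cong (punchIn p) eq) (sym (extend-punchIn π (suc y)))))
    (trans (cong (λ i → forced d u i (punchIn h y)) (extend-punchIn π₁ (suc y))))
    (same y)

-- Large clauses that force the entry are no longer alive, and no clause becomes large because
-- weights can only drop.
restrict-#large : ∀ {N S} (d : Derivation (suc N) S) w p h →
  #large (restrict d p h) w + ∑[ u < S ] (indicator (large d w u) * indicator (forced d u p h))
    ≤ #large d w
restrict-#large {N} {S} d w p h = ≤-trans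
  (≤-reflexive (sym (∑-distrib-+ (indicator ∘ large (restrict d p h) w) _)))
  (sum-mono-≤ pointwise)
  where
  weight-≤ : ∀ u → weight (restrict d p h) u ≤ weight d u
  weight-≤ u = ≤-trans
    (sum-mono-≤ λ p′ → sum-punchIn-≤ (λ h′ → indicator (forced d u (punchIn p p′) h′)) h)
    (sum-punchIn-≤ (λ p′ → ∑[ h′ < suc N ] indicator (forced d u p′ h′)) p)

  pointwise : ∀ u → indicator (large (restrict d p h) w u) +
                    indicator (large d w u) * indicator (forced d u p h) ≤ indicator (large d w u)
  pointwise u with alive d u | forced d u p h
  ... | false | _     = z≤n
  ... | true  | true  = ≤-reflexive (*-identityʳ _)
  ... | true  | false
    rewrite *-zeroʳ (indicator (w ≤ᵇ weight d u)) | +-identityʳ (indicator (w ≤ᵇ weight (restrict d p h) u))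
    with w ≤ᵇ weight (restrict d p h) u in le
  ...   | false = z≤n
  ...   | true  rewrite ≤ᵇ-true (≤-trans (≤ᵇ-true⁻¹ w _ le) (weight-≤ u)) = ≤-refl

-- The entry (p , h) is one that is forced in at least the average number of
-- large clauses; restricting by it kills all of these.
shrink : ∀ {N S} (d : Derivation (suc N) S) w → suc (suc N) * suc N ≤ 36 * suc w →
  ∃₂ λ p h → 36 * #large (restrict d p h) (suc w) ≤ 35 * #large d (suc w)
shrink {N} {S} d w′ size≤ = p , h , +-cancelʳ-≤ L _ _ (begin
    36 * L′ + L         ≤⟨ +-monoʳ-≤ (36 * L′) L≤36K ⟩
    36 * L′ + 36 * K p h ≡⟨ *-distribˡ-+ 36 L′ (K p h) ⟨
    36 * (L′ + K p h)   ≤⟨ *-monoʳ-≤ 36 (restrict-#large d w p h) ⟩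
    36 * L              ≡⟨ +-comm L (35 * L) ⟩
    35 * L + L          ∎)
  where
  open ≤-Reasoning
  w = suc w′
  L = #large d w

  K : Fin (suc (suc N)) → Fin (suc N) → ℕ
  K p h = ∑[ u < S ] (indicator (large d w u) * indicator (forced d u p h))

  best-row = above-average (λ p → sum (K p))
  p        = proj₁ best-row
  best     = above-average (K p)
  h        = proj₁ best
  L′       = #large (restrict d p h) w

  large-weight : ∀ u → indicator (large d w u) * w ≤ indicator (large d w u) * weight d u
  large-weight u with alive d u
  ... | false = z≤n
  ... | true with w ≤ᵇ weight d u in le
  ...   | false = z≤n
  ...   | true  = +-monoˡ-≤ 0 (≤ᵇ-true⁻¹ w _ le)

  swap-sums : ∑[ u < S ] (indicator (large d w u) * weight d u) ≡ ∑[ p < suc (suc N) ] sum (K p)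
  swap-sums =
    ≡-Reasoning.begin
      ∑[ u < S ] (ℓ u * weight d u)
    ≡-Reasoning.≡⟨ sum-cong-≗ (λ u → trans (*-distribˡ-sum (ℓ u) (λ p → sum (f u p)))
                                           (sum-cong-≗ λ p → *-distribˡ-sum (ℓ u) (f u p))) ⟩
      ∑[ u < S ] ∑[ p < suc (suc N) ] ∑[ h < suc N ] (ℓ u * f u p h)
    ≡-Reasoning.≡⟨ ∑-comm (λ u p → ∑[ h < suc N ] (ℓ u * f u p h)) ⟩
      ∑[ p < suc (suc N) ] ∑[ u < S ] ∑[ h < suc N ] (ℓ u * f u p h)
    ≡-Reasoning.≡⟨ sum-cong-≗ (λ p → ∑-comm λ u h → ℓ u * f u p h) ⟩
      ∑[ p < suc (suc N) ] sum (K p)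
    ≡-Reasoning.∎
    where
    ℓ = λ u → indicator (large d w u)
    f = λ u p h → indicator (forced d u p h)

  -- Double counting: large clauses have at least `L * w` forced entries in all, spread over at most
  -- `36 * w` positions. Cancelling `w` is allowed because it is a successor.
  L≤36K : L ≤ 36 * K p h
  L≤36K = *-cancelʳ-≤ L (36 * K p h) w (begin
    L * w                                             ≡⟨ *-distribʳ-sum w (indicator ∘ large d w) ⟩
    ∑[ u < S ] (indicator (large d w u) * w)          ≤⟨ sum-mono-≤ large-weight ⟩
    ∑[ u < S ] (indicator (large d w u) * weight d u) ≡⟨ swap-sums ⟩
    ∑[ p < suc (suc N) ] sum (K p)                    ≤⟨ proj₂ best-row ⟩
    suc (suc N) * sum (K p)                           ≤⟨ *-monoʳ-≤ (suc (suc N)) (proj₂ best) ⟩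
    suc (suc N) * (suc N * K p h)                     ≡⟨ *-assoc (suc (suc N)) (suc N) (K p h) ⟨
    suc (suc N) * suc N * K p h                       ≤⟨ *-monoˡ-≤ (K p h) size≤ ⟩
    36 * w * K p h                                    ≡⟨ rearrange-* 36 w (K p h) ⟩
    36 * K p h * w                                    ∎)
    where
    rearrange-* : ∀ a b c → a * b * c ≡ a * c * b
    rearrange-* = solve-∀

-- The threshold stays fixed while the number of entries falls, so the hypothesis of the averaging
-- step survives every round.
shrink-repeatedly : ∀ t {N S} (d : Derivation (t + N) S) w → suc (t + N) * (t + N) ≤ 36 * suc w →
  Σ[ d′ ∈ Derivation N S ] (36 ^ t * #large d′ (suc w) ≤ 35 ^ t * #large d (suc w))
shrink-repeatedly zero    d w size≤ = d , ≤-refl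
shrink-repeatedly (suc t) {N} d w size≤ =
  let p , h , step = shrink d w size≤
      d′ , steps   = shrink-repeatedly t (restrict d p h) w
        (≤-trans (*-mono-≤ (n≤1+n (suc (t + N))) (n≤1+n (t + N))) size≤)
  in d′ , (begin
    36 * 36 ^ t * #large d′ (suc w)               ≡⟨ *-assoc 36 (36 ^ t) _ ⟩
    36 * (36 ^ t * #large d′ (suc w))             ≤⟨ *-monoʳ-≤ 36 steps ⟩
    36 * (35 ^ t * #large (restrict d p h) (suc w)) ≡⟨ exchange 36 (35 ^ t) _ ⟩
    35 ^ t * (36 * #large (restrict d p h) (suc w)) ≤⟨ *-monoʳ-≤ (35 ^ t) step ⟩
    35 ^ t * (35 * #large d (suc w))              ≡⟨ regroup (35 ^ t) 35 _ ⟩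
    35 * 35 ^ t * #large d (suc w)                ∎)
  where
  open ≤-Reasoning
  exchange : ∀ a b c → a * (b * c) ≡ b * (a * c)
  exchange = solve-∀
  regroup : ∀ a b c → a * (b * c) ≡ b * a * c
  regroup = solve-∀

-- Missing pigeons as a complexity measure, and the size bound.

sum≡0⇒≡0 : ∀ {n} (f : Fin n → ℕ) → sum f ≡ 0 → ∀ i → f i ≡ 0
sum≡0⇒≡0 f sum≡0 zero    = m+n≡0⇒m≡0 (f zero) sum≡0
sum≡0⇒≡0 f sum≡0 (suc i) = sum≡0⇒≡0 (f ∘ suc) (m+n≡0⇒n≡0 (f zero) sum≡0) i

indicator-≤1 : ∀ b → indicator b ≤ 1
indicator-≤1 false = z≤n
indicator-≤1 true  = ≤-refl

Critical : ∀ {N S} → Derivation N S → Fin S → Fin (suc N) → Set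
Critical d u i = ∃ λ π → π ⟨$⟩ʳ zero ≡ i × Falsifies d π u

-- Decidability of `Critical` is assumed so that the complexity `μ u`, the number of critical
-- pigeons of `u`, can be counted.
module Complexity {N S q} (d : Derivation N S) (2≤q : 2 ≤ q) (3q≤N : 3 * q ≤ suc N)
  (small : ∀ u → large d (q * q) u ≡ false)
  (critical? : ∀ u i → Dec (Critical d u i)) where

  open ≤-Reasoning

  critical : Fin S → Fin (suc N) → Bool
  critical u i = does (critical? u i)

  μ μᶜ : Fin S → ℕ
  μ  u = sum (indicator ∘ critical u)
  μᶜ u = sum (indicator ∘ not ∘ critical u)

  μ+μᶜ : ∀ u → μ u + μᶜ u ≡ suc N
  μ+μᶜ u = trans (sym (∑-distrib-+ (indicator ∘ critical u) (indicator ∘ not ∘ critical u)))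
                 (trans (sum-cong-≗ (λ i → complement (critical u i))) (sum-one (suc N)))
    where
    complement : ∀ b → indicator b + indicator (not b) ≡ 1
    complement false = refl
    complement true  = refl

  -- If u is falsified when pigeon π zero is left out but not when the pigeon
  -- of hole h is left out, exchanging the two must satisfy u.
  exchange : ∀ {u} π → Falsifies d π u → ∀ h →
    indicator (not (critical u (π ⟨$⟩ʳ suc h))) ≤ indicator (forced d u (π ⟨$⟩ʳ zero) h)
  exchange {u} π fals h with forced d u (π ⟨$⟩ʳ zero) h in unforced
  ... | true  = indicator-≤1 _
  ... | false = ≤-trans (≤-reflexive (cong (indicator ∘ not)
      (dec-true (critical? u (π ⟨$⟩ʳ suc h)) (π₁ , refl , falsifies-update d fals same)))) z≤n
    where
    π₁ = transpose zero (suc h) ∘ₚ π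
    same : ∀ x → π₁ ⟨$⟩ʳ suc x ≡ π ⟨$⟩ʳ suc x ⊎ forced d u (π₁ ⟨$⟩ʳ suc x) x ≡ false
    same x with x ≟ h
    ... | yes refl = inj₂ unforced
    ... | no  _    = inj₁ refl

  -- Fix an assignment that leaves out `i` and falsifies `u`. Every non-critical pigeon sits in some
  -- hole of it, and by `exchange` that hole gives a forced entry in row `i`.
  row-weight : ∀ u i → indicator (critical u i) * μᶜ u ≤ ∑[ h < N ] indicator (forced d u i h)
  row-weight u i with critical? u i
  ... | no  _                = z≤n
  ... | yes (π , refl , fals) = begin
    μᶜ u + 0                                         ≡⟨ +-identityʳ (μᶜ u) ⟩
    μᶜ u                                             ≡⟨ sum-permute (indicator ∘ not ∘ critical u) π ⟩
    indicator (not (critical u (π ⟨$⟩ʳ zero))) +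
      ∑[ h < N ] indicator (not (critical u (π ⟨$⟩ʳ suc h)))
        ≡⟨ cong (λ b → indicator (not b) + ∑[ h < N ] indicator (not (critical u (π ⟨$⟩ʳ suc h))))
             (dec-true (critical? u (π ⟨$⟩ʳ zero)) (π , refl , fals)) ⟩
    ∑[ h < N ] indicator (not (critical u (π ⟨$⟩ʳ suc h))) ≤⟨ sum-mono-≤ (exchange π fals) ⟩
    ∑[ h < N ] indicator (forced d u (π ⟨$⟩ʳ zero) h) ∎

  μ*μᶜ≤weight : ∀ u → μ u * μᶜ u ≤ weight d u
  μ*μᶜ≤weight u = begin
    μ u * μᶜ u                                        ≡⟨ *-distribʳ-sum (μᶜ u) (indicator ∘ critical u) ⟩
    ∑[ i < suc N ] (indicator (critical u i) * μᶜ u)  ≤⟨ sum-mono-≤ (row-weight u) ⟩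
    weight d u                                        ∎

  -- A clause that is not alive is never falsified. For a live one, a value from `q` up to `2q`
  -- would leave at least `q` non-critical pigeons, so its weight would be at least `q * q` and it
  -- would be large.
  μ-not-medium : ∀ u → μ u < q + q → μ u < q
  μ-not-medium u μ<2q with alive d u in living
  ... | false = begin-strict
    μ u ≡⟨ sum-zero none ⟩
    0   <⟨ s≤s z≤n ⟩
    2   ≤⟨ 2≤q ⟩
    q   ∎
    where
    none : ∀ i → indicator (critical u i) ≡ 0
    none i with critical? u i
    ... | no _ = refl
    ... | yes (_ , _ , fals) with () ← trans (sym living) (falsified⇒alive d fals)
  ... | true = ≰⇒> λ q≤μ → contradiction
    (trans (sym (cong₂ _∧_ living (≤ᵇ-true (heavy q≤μ)))) (small u)) λ ()
    where
    q≤μᶜ : q ≤ μᶜ u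
    q≤μᶜ = +-cancelˡ-≤ (q + q) q (μᶜ u) (begin
      q + q + q    ≡⟨ triple q ⟩
      3 * q        ≤⟨ 3q≤N ⟩
      suc N        ≡⟨ μ+μᶜ u ⟨
      μ u + μᶜ u   ≤⟨ +-monoˡ-≤ (μᶜ u) (<⇒≤ μ<2q) ⟩
      q + q + μᶜ u ∎)
      where
      triple : ∀ q → q + q + q ≡ 3 * q
      triple = solve-∀
    heavy : q ≤ μ u → q * q ≤ weight d u
    heavy q≤μ = ≤-trans (*-mono-≤ q≤μ q≤μᶜ) (μ*μᶜ≤weight u)

  μ-subadditive : ∀ {u a b} → (∀ {π} → Falsifies d π u → Falsifies d π a ⊎ Falsifies d π b) →
    μ u ≤ μ a + μ b
  μ-subadditive {u} {a} {b} step = ≤-trans (sum-mono-≤ pointwise)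
    (≤-reflexive (∑-distrib-+ (indicator ∘ critical a) (indicator ∘ critical b)))
    where
    pointwise : ∀ i → indicator (critical u i) ≤ indicator (critical a i) + indicator (critical b i)
    pointwise i with critical? u i
    ... | no  _ = z≤n
    ... | yes (π , π₀≡i , fals) with step fals
    ...   | inj₁ fals-a rewrite dec-true (critical? a i) (π , π₀≡i , fals-a) = s≤s z≤n
    ...   | inj₂ fals-b rewrite dec-true (critical? b i) (π , π₀≡i , fals-b) = m≤n+m 1 _

  critical-true : ∀ {u} i → critical u i ≡ true → Critical d u i
  critical-true {u} i eq with critical? u i
  ... | yes crit = crit

  -- Induction along the graph: two premises below `q` give a conclusion below `2q`, and the gap
  -- pushes it below `q` again.
  μ<q : ∀ u → Acc (_≺_ d) u → μ u < q
  μ<q u (acc below) with inference d u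
  ... | inj₁ unique = <-≤-trans (s≤s (sum-indicator-≤1 (critical u) at-most-one)) 2≤q
    where
    at-most-one : ∀ i j → critical u i ≡ true → critical u j ≡ true → i ≡ j
    at-most-one i j critᵢ critⱼ =
      let _ , π₀≡i , falsᵢ = critical-true i critᵢ
          _ , π₀≡j , falsⱼ = critical-true j critⱼ
      in trans (sym π₀≡i) (trans (unique falsᵢ falsⱼ) π₀≡j)
  ... | inj₂ (a , b , a≺u , b≺u , step) = μ-not-medium u
    (≤-<-trans (μ-subadditive step) (+-mono-< (μ<q a (below a≺u)) (μ<q b (below b≺u))))

  μ-sink : μ (sink d) ≡ suc N
  μ-sink = trans (sum-cong-≗ λ i → cong indicator
      (dec-true (critical? (sink d) i) (transpose zero i , refl , sink-falsified d _)))
    (sum-one (suc N))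

  absurd : ⊥
  absurd = <⇒≱ (μ<q (sink d) (≺-wellFounded d (sink d)))
    (≤-trans (m≤m+n q _) (≤-trans 3q≤N (≤-reflexive (sym μ-sink))))

-- The goal is a negation, so the finitely many instances of excluded middle for `Critical` may be
-- used jointly under double negation.
large-exists : ∀ {N S q} (d : Derivation N S) → 2 ≤ q → 3 * q ≤ suc N → #large d (q * q) ≢ 0
large-exists {q = q} d 2≤q 3q≤N none =
  sequence applicative (λ u → sequence applicative (λ i → ¬¬-excluded-middle {A = Critical d u i}))
    (Complexity.absurd d 2≤q 3q≤N small)
  where
  applicative = RawMonad.rawApplicative ¬¬-Monad
  small : ∀ u → large d (q * q) u ≡ false
  small u with large d (q * q) u | sum≡0⇒≡0 (indicator ∘ large d (q * q)) none u
  ... | false | _ = refl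

derivation-size : ∀ {N S} q → 2 ≤ q → suc N ≡ 6 * q → Derivation N S → 36 ^ (3 * q) ≤ 35 ^ (3 * q) * S
derivation-size {N} {S} (suc q) 2≤q N+1≡6q d = bound (shrink-repeatedly t d₀ w size≤)
  where
  open ≤-Reasoning
  -- With Q for `suc q`: 3Q placements are made, the threshold `suc w` is Q * Q, and `M` = 3Q - 1
  -- holes remain for 3Q pigeons.
  t = 3 * suc q
  w = q + q * suc q
  M = 2 + 3 * q
  arith : ∀ q → suc (3 * suc q + (2 + 3 * q)) ≡ 6 * suc q
  arith = solve-∀
  N≡t+M : N ≡ t + M
  N≡t+M = suc-injective (trans N+1≡6q (sym (arith q)))
  d₀ : Derivation (t + M) S
  d₀ = subst (λ N → Derivation N S) N≡t+M d
  size≤ : suc (t + M) * (t + M) ≤ 36 * suc w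
  size≤ = begin
    suc (t + M) * (t + M)       ≤⟨ *-monoʳ-≤ (suc (t + M)) (n≤1+n (t + M)) ⟩
    suc (t + M) * suc (t + M)   ≡⟨ cong (λ x → x * x) (arith q) ⟩
    6 * suc q * (6 * suc q)     ≡⟨ square q ⟩
    36 * suc w                  ∎
    where
    square : ∀ q → 6 * suc q * (6 * suc q) ≡ 36 * suc (q + q * suc q)
    square = solve-∀
  bound : Σ[ d′ ∈ Derivation M S ] (36 ^ t * #large d′ (suc w) ≤ 35 ^ t * #large d₀ (suc w)) →
    36 ^ t ≤ 35 ^ t * S
  bound (d′ , steps) = begin
    36 ^ t                          ≡⟨ *-identityʳ (36 ^ t) ⟨
    36 ^ t * 1                      ≤⟨ *-monoʳ-≤ (36 ^ t) (n≢0⇒n>0 (large-exists d′ 2≤q 3q≤M)) ⟩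
    36 ^ t * #large d′ (suc w)      ≤⟨ steps ⟩
    35 ^ t * #large d₀ (suc w)      ≤⟨ *-monoʳ-≤ (35 ^ t) all ⟩
    35 ^ t * S                      ∎
    where
    all : #large d₀ (suc w) ≤ S
    all = ≤-trans (sum-mono-≤ λ u → indicator-≤1 (large d₀ (suc w) u)) (≤-reflexive (sum-one S))
    3q≤M : 3 * suc q ≤ suc M
    3q≤M = ≤-reflexive (triple q)
      where
      triple : ∀ q → 3 * suc q ≡ suc (2 + 3 * q)
      triple = solve-∀

-- Exponential against polynomial growth.

^-distribʳ-* : ∀ o m n → (m * n) ^ o ≡ m ^ o * n ^ o
^-distribʳ-* zero    m n = refl
^-distribʳ-* (suc o) m n = trans (cong (m * n *_) (^-distribʳ-* o m n)) (interchange m n (m ^ o) (n ^ o))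
  where
  interchange : ∀ a b c d → a * b * (c * d) ≡ a * c * (b * d)
  interchange = solve-∀

n<2^n : ∀ n → n < 2 ^ n
n<2^n zero    = s≤s z≤n
n<2^n (suc n) = +-mono-≤ (m^n>0 2 n) (≤-trans (n<2^n n) (m≤m+n (2 ^ n) 0))

-- By Bernoulli's inequality (1 + 1/35)^35 is at least 2; this instance is checked by computation.
36^35j≥2^j*35^35j : ∀ j → 2 ^ j * 35 ^ (35 * j) ≤ 36 ^ (35 * j)
36^35j≥2^j*35^35j j = begin
  2 ^ j * 35 ^ (35 * j)    ≡⟨ cong (2 ^ j *_) (^-*-assoc 35 35 j) ⟨
  2 ^ j * (35 ^ 35) ^ j    ≡⟨ ^-distribʳ-* j 2 (35 ^ 35) ⟨
  (2 * 35 ^ 35) ^ j        ≤⟨ ^-monoˡ-≤ j (≤ᵇ⇒≤ (2 * 35 ^ 35) (36 ^ 35) tt) ⟩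
  (36 ^ 35) ^ j            ≡⟨ ^-*-assoc 36 35 j ⟩
  36 ^ (35 * j)            ∎
  where open ≤-Reasoning

exponential-beats-linear : ∀ A c → ∃ λ x → A + x * c < 2 ^ x
-- For y = A + 2c the left side is at most 2y + y * y, which is less than (1 + y)^2.
exponential-beats-linear A c = y + y , (begin
  suc (A + (y + y) * c)              ≡⟨ cong suc (expand A c) ⟩
  suc (A + y * (c + c))              ≤⟨ s≤s (+-mono-≤ (≤-trans (m≤m+n A (c + c)) (m≤m+n y y))
                                                      (*-monoʳ-≤ y (m≤n+m (c + c) A))) ⟩
  suc (y + y + y * y)                ≡⟨ square y ⟩
  suc y * suc y                      ≤⟨ *-mono-≤ (n<2^n y) (n<2^n y) ⟩
  2 ^ y * 2 ^ y                      ≡⟨ ^-distribˡ-+-* 2 y y ⟨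
  2 ^ (y + y)                        ∎)
  where
  open ≤-Reasoning
  y = A + (c + c)
  expand : ∀ A c → A + (A + (c + c) + (A + (c + c))) * c ≡ A + (A + (c + c)) * (c + c)
  expand = solve-∀
  square : ∀ y → 1 + (y + y + y * y) ≡ (1 + y) * (1 + y)
  square = solve-∀

exponential-beats-polynomial : ∀ K b c → ∃ λ m → 0 < m × K * (b * m) ^ c < 2 ^ m
exponential-beats-polynomial K b c with exponential-beats-linear (K * b ^ c) c
-- Taking a power of two for `m` reduces the claim to comparing exponents, where one side is linear
-- in `x`.
... | x , lt = 2 ^ x , m^n>0 2 x , (begin-strict
  K * (b * 2 ^ x) ^ c           ≡⟨ cong (K *_) (^-distribʳ-* c b (2 ^ x)) ⟩
  K * (b ^ c * (2 ^ x) ^ c)     ≡⟨ *-assoc K (b ^ c) _ ⟨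
  K * b ^ c * (2 ^ x) ^ c       ≡⟨ cong (K * b ^ c *_) (^-*-assoc 2 x c) ⟩
  K * b ^ c * 2 ^ (x * c)       ≤⟨ *-monoˡ-≤ (2 ^ (x * c)) (<⇒≤ (n<2^n (K * b ^ c))) ⟩
  2 ^ (K * b ^ c) * 2 ^ (x * c) ≡⟨ ^-distribˡ-+-* 2 (K * b ^ c) (x * c) ⟨
  2 ^ (K * b ^ c + x * c)       <⟨ ^-monoʳ-< 2 ≤-refl lt ⟩
  2 ^ (2 ^ x)                   ∎)
  where open ≤-Reasoning

size-bound-fails : ∀ K c a → ∃ λ q → 2 ≤ q ×
  35 ^ (3 * q) * (K * (a + 6 * q) ^ c) < 36 ^ (3 * q)
size-bound-fails K c a with exponential-beats-polynomial K (a + 210) c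
-- A multiple of 35 lets powers of 36/35 be traded for powers of 2; 210 is 6 * 35.
... | m , 0<m , lt = 35 * m , ≤-trans (≤ᵇ⇒≤ 2 35 tt) (m≤m*n 35 m) , (begin-strict
  35 ^ (3 * (35 * m)) * (K * (a + 6 * (35 * m)) ^ c)
    ≡⟨ cong (λ e → 35 ^ e * (K * (a + 6 * (35 * m)) ^ c)) (regroup m) ⟩
  35 ^ (35 * (3 * m)) * (K * (a + 6 * (35 * m)) ^ c)
    ≤⟨ *-monoʳ-≤ (35 ^ (35 * (3 * m))) (*-monoʳ-≤ K (^-monoˡ-≤ c linear)) ⟩
  35 ^ (35 * (3 * m)) * (K * ((a + 210) * m) ^ c)
    <⟨ *-monoʳ-< (35 ^ (35 * (3 * m))) (<-≤-trans lt (^-monoʳ-≤ 2 (m≤n*m m 3))) ⟩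
  35 ^ (35 * (3 * m)) * 2 ^ (3 * m)
    ≡⟨ *-comm (35 ^ (35 * (3 * m))) (2 ^ (3 * m)) ⟩
  2 ^ (3 * m) * 35 ^ (35 * (3 * m))
    ≤⟨ 36^35j≥2^j*35^35j (3 * m) ⟩
  36 ^ (35 * (3 * m))
    ≡⟨ cong (36 ^_) (regroup m) ⟨
  36 ^ (3 * (35 * m)) ∎)
  where
  open ≤-Reasoning
  instance
    m-nonZero : NonZero m
    m-nonZero = >-nonZero 0<m
    power-nonZero : NonZero (35 ^ (35 * (3 * m)))
    power-nonZero = m^n≢0 35 (35 * (3 * m))
  regroup : ∀ m → 3 * (35 * m) ≡ 35 * (3 * m)
  regroup = solve-∀
  linear : a + 6 * (35 * m) ≤ (a + 210) * m
  linear = begin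
    a + 6 * (35 * m)   ≤⟨ +-monoˡ-≤ (6 * (35 * m)) (m≤m*n a m) ⟩
    a * m + 6 * (35 * m) ≡⟨ collect a m ⟩
    (a + 210) * m      ∎
    where
    collect : ∀ a m → a * m + 6 * (35 * m) ≡ (a + 210) * m
    collect = solve-∀

-- Clauses evaluated at critical assignments.

odd-form : ∀ k → 2 ∤ k → ∃ λ a → k ≡ suc (a * 2)
odd-form zero          2∤k = contradiction (2 ∣0) 2∤k
odd-form (suc zero)    2∤k = 0 , refl
odd-form (suc (suc k)) 2∤k with odd-form k (λ 2∣k → 2∤k (∣m∣n⇒∣m+n ∣-refl 2∣k))
... | a , refl = suc a , refl

-- An even cut falls between two pairs; this is where the oddness of k enters.
pairs-split : ∀ a n {i j} → (i , j) ∈ pairs n →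
  (toℕ i < a * 2 → toℕ j < a * 2) × (toℕ j < a * 2 → toℕ i < a * 2)
pairs-split zero    n             _           = (λ ()) , (λ ())
pairs-split (suc a) (suc (suc n)) (here refl) = (λ _ → s≤s (s≤s z≤n)) , (λ _ → s≤s z≤n)
pairs-split (suc a) (suc (suc n)) (there ij∈) with ∈-map⁻ _ ij∈
... | _ , ij∈′ , refl with pairs-split a n ij∈′
...   | i⇒j , j⇒i = (λ { (s≤s (s≤s lt)) → s≤s (s≤s (i⇒j lt)) })
                  , (λ { (s≤s (s≤s lt)) → s≤s (s≤s (j⇒i lt)) })

∈others⇒≢ : ∀ {n} (i l : Fin n) → l ∈ others i → i ≢ l
∈others⇒≢ {n} i l l∈ = proj₂ (∈-filter⁻ (λ l → ¬? (i ≟ l)) {xs = allFin n} l∈)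

-- The transitive closure is a strict partial order on a finite set.
acyclic⇒wellFounded : ∀ {n} {E : Fin n → Fin n → Set} →
  (∀ u → ¬ TransClosure E u u) → WellFounded (TransClosure E)
acyclic⇒wellFounded acyclic = spo-wellFounded record
  { isEquivalence = isEquivalence
  ; irrefl        = λ { refl → acyclic _ }
  ; trans         = transitive _
  ; <-resp-≈      = resp₂ _
  }

-- The first 2a variables v are true and the others false.  Then k = 2a + 1
-- leaves the clauses on r satisfiable, whereas the n − 2a indices of false
-- variables are pigeons for the n − k = n − 2a − 1 holes of s.
module CriticalAssignments (a n : ℕ)
  (n≡2a+1+H : a * 2 + suc (n ∸ suc (a * 2)) ≡ n) where

  k H : ℕ
  k = suc (a * 2)
  H = n ∸ k

  pigeon : Fin (suc H) → Fin n
  pigeon p = cast n≡2a+1+H (a * 2 ↑ʳ p)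

  toℕ-pigeon : ∀ p → toℕ (pigeon p) ≡ a * 2 + toℕ p
  toℕ-pigeon p = trans (toℕ-cast n≡2a+1+H _) (toℕ-↑ʳ (a * 2) p)

  pigeon-injective : ∀ {p q} → pigeon p ≡ pigeon q → p ≡ q
  pigeon-injective {p} {q} eq = toℕ-injective (+-cancelˡ-≡ (a * 2) _ _
    (trans (sym (toℕ-pigeon p)) (trans (cong toℕ eq) (toℕ-pigeon q))))

  false-index : ∀ i → ¬ toℕ i < a * 2 → ∃ λ p → pigeon p ≡ i
  false-index i i≮2a = fromℕ< lt , toℕ-injective
    (trans (toℕ-pigeon _) (trans (cong (a * 2 +_) (toℕ-fromℕ< lt)) (m+[n∸m]≡n (≮⇒≥ i≮2a))))
    where
    lt : toℕ i ∸ a * 2 < suc H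
    lt = m<n+o⇒m∸n<o (toℕ i) (a * 2) (subst (toℕ i <_) (sym n≡2a+1+H) (toℕ<n i))

  Occupancy : Set
  Occupancy = Fin H → Fin (suc H)

  -- Putting `r` on the diagonal satisfies its clauses, as all true indices lie below `k`. Only `s`
  -- varies with the occupancy.
  Holds : Occupancy → Var n k → Set
  Holds g (v i)   = toℕ i < a * 2
  Holds g (r i l) = toℕ i ≡ toℕ l
  Holds g (s i h) = pigeon (g h) ≡ i

  holds? : ∀ g x → Dec (Holds g x)
  holds? g (v i)   = toℕ i <? a * 2
  holds? g (r i l) = toℕ i ℕ.≟ toℕ l
  holds? g (s i h) = pigeon (g h) ≟ i

  LitHolds : Occupancy → Literal (Var n k) → Set
  LitHolds g (pos x) = Holds g x
  LitHolds g (neg x) = ¬ Holds g x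

  Falsified : Occupancy → Clause (Var n k) → Set
  Falsified g C = ∀ {l} → l ∈ C → ¬ LitHolds g l

  -- The monotone translation: since a hole holds exactly one pigeon, a negated `s i h` says that
  -- `h` holds a pigeon other than `i`. Literals on `v` and `r` have constant values and force
  -- nothing.
  Forces : Fin (suc H) → Fin H → Literal (Var n k) → Set
  Forces p h (pos (s i h′)) = h′ ≡ h × pigeon p ≡ i
  Forces p h (neg (s i h′)) = h′ ≡ h × pigeon p ≢ i
  Forces p h _              = ⊥

  forces? : ∀ p h l → Dec (Forces p h l)
  forces? p h (pos (s i h′)) = (h′ ≟ h) ×-dec (pigeon p ≟ i)
  forces? p h (neg (s i h′)) = (h′ ≟ h) ×-dec ¬? (pigeon p ≟ i)
  forces? p h (pos (v _))    = no id
  forces? p h (pos (r _ _))  = no id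
  forces? p h (neg (v _))    = no id
  forces? p h (neg (r _ _))  = no id

  forces⇒holds : ∀ g h l → Forces (g h) h l → LitHolds g l
  forces⇒holds g h (pos (s i .h)) (refl , eq) = eq
  forces⇒holds g h (neg (s i .h)) (refl , ne) = ne

  forcedBy? : ∀ C p h → Dec (Any (Forces p h) C)
  forcedBy? C p h = any? (forces? p h) C

  falsified⇒unforcedBy : ∀ {g C} → Falsified g C → ∀ h → does (forcedBy? C (g h) h) ≡ false
  falsified⇒unforcedBy {g} {C} fals h = dec-false (forcedBy? C (g h) h) λ forced →
    let l , l∈C , forces = find forced in fals l∈C (forces⇒holds g h l forces)

  unforcedBy⇒¬forces : ∀ {C p h l} → does (forcedBy? C p h) ≡ false → l ∈ C → ¬ Forces p h l
  unforcedBy⇒¬forces {C} {p} {h} unforced l∈C forces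
    with () ← trans (sym unforced) (dec-true (forcedBy? C p h) (lose l∈C forces))

  -- A literal on `s` looks at a single hole, so the holes can be treated one by one.
  falsified-update : ∀ {g g₁ C} → Falsified g C →
    (∀ h → g₁ h ≡ g h ⊎ does (forcedBy? C (g₁ h) h) ≡ false) → Falsified g₁ C
  falsified-update fals same {pos (v _)}   l∈C = fals l∈C
  falsified-update fals same {neg (v _)}   l∈C = fals l∈C
  falsified-update fals same {pos (r _ _)} l∈C = fals l∈C
  falsified-update fals same {neg (r _ _)} l∈C = fals l∈C
  falsified-update fals same {pos (s i h)} l∈C eq with same h
  ... | inj₁ g₁h≡gh   = fals l∈C (trans (cong pigeon (sym g₁h≡gh)) eq)
  ... | inj₂ unforced = unforcedBy⇒¬forces unforced l∈C (refl , eq)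
  falsified-update fals same {neg (s i h)} l∈C ne with same h
  ... | inj₁ g₁h≡gh   = fals l∈C (ne ∘ trans (cong pigeon g₁h≡gh))
  ... | inj₂ unforced = unforcedBy⇒¬forces unforced l∈C (refl , ne)

  occupancy : Permutation′ (suc H) → Occupancy
  occupancy π h = π ⟨$⟩ʳ suc h

  -- The index `i` must be a pigeon since `v i` is false, and its position under the inverse of `π`
  -- cannot be a hole, as that would make an `s` literal true.
  falsified-s-clause : ∀ π i → Falsified (occupancy π) (pos (v i) ∷ map (λ l → pos (s i l)) (allFin H)) →
    pigeon (π ⟨$⟩ʳ zero) ≡ i
  falsified-s-clause π i fals with false-index i (fals (here refl))
  ... | p , refl with π ⟨$⟩ˡ p | inverseʳ π {p}
  ...   | zero  | π₀≡p = cong pigeon π₀≡p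
  ...   | suc h | πₕ≡p =
    contradiction (cong pigeon πₕ≡p) (fals (there (∈-map⁺ _ (∈-allFin h))))

  pair-satisfied : ∀ {C i j} → (i , j) ∈ pairs n →
    C ∈ (pos (v i) ∷ neg (v j) ∷ []) ∷ (pos (v j) ∷ neg (v i) ∷ []) ∷ [] → ∀ g → ¬ Falsified g C
  pair-satisfied ij∈ (here refl) g fals =
    fals (there (here refl)) λ vⱼ → fals (here refl) (proj₂ (pairs-split a n ij∈) vⱼ)
  pair-satisfied ij∈ (there (here refl)) g fals =
    fals (there (here refl)) λ vᵢ → fals (here refl) (proj₁ (pairs-split a n ij∈) vᵢ)

  r-clause-satisfied : ∀ i g → ¬ Falsified g (neg (v i) ∷ map (λ l → pos (r i l)) (allFin k))
  r-clause-satisfied i g fals = fals (here refl) λ vᵢ → let i<k = m<n⇒m<1+n vᵢ in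
    fals (there (∈-map⁺ _ (∈-allFin (fromℕ< i<k)))) (sym (toℕ-fromℕ< i<k))

  r-exclusion-satisfied : ∀ {i l} j → i ≢ l → ∀ g →
    ¬ Falsified g (neg (v i) ∷ neg (r i j) ∷ neg (r l j) ∷ [])
  r-exclusion-satisfied j i≢l g fals =
    fals (there (here refl)) λ rᵢⱼ → fals (there (there (here refl))) λ rₗⱼ →
    i≢l (toℕ-injective (trans rᵢⱼ (sym rₗⱼ)))

  s-exclusion-satisfied : ∀ {i l} j → i ≢ l → ∀ g →
    ¬ Falsified g (pos (v i) ∷ neg (s i j) ∷ neg (s l j) ∷ [])
  s-exclusion-satisfied j i≢l g fals =
    fals (there (here refl)) λ sᵢⱼ → fals (there (there (here refl))) λ sₗⱼ →
    i≢l (trans (sym sᵢⱼ) sₗⱼ)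

  initial-cases : ∀ {C} → C ∈ Ψ′ n k → (∀ g → ¬ Falsified g C) ⊎
    ∃ λ i → C ≡ pos (v i) ∷ map (λ l → pos (s i l)) (allFin H)
  initial-cases C∈ with ∈-++⁻ (Ψ n k) C∈
  ... | inj₁ C∈Ψ =
    let _ , ij∈ , C∈ᵢⱼ = find (∈-concatMap⁻ _ {xs = pairs n} C∈Ψ) in inj₁ (pair-satisfied ij∈ C∈ᵢⱼ)
  ... | inj₂ C∈₁ with ∈-++⁻ (map (λ i → neg (v i) ∷ map (λ l → pos (r i l)) (allFin k)) (allFin n)) C∈₁
  ...   | inj₁ C∈r with ∈-map⁻ _ C∈r
  ...     | i , _ , refl = inj₁ (r-clause-satisfied i)
  initial-cases C∈ | inj₂ _ | inj₂ C∈₂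
    with ∈-++⁻ (concatMap (λ i → concatMap (λ l → map
           (λ j → neg (v i) ∷ neg (r i j) ∷ neg (r l j) ∷ []) (allFin k)) (others i)) (allFin n)) C∈₂
  ... | inj₁ C∈r with find (∈-concatMap⁻ _ {xs = allFin n} C∈r)
  ...   | i , _ , C∈rᵢ with find (∈-concatMap⁻ _ {xs = others i} C∈rᵢ)
  ...     | l , l∈ , C∈rᵢₗ with ∈-map⁻ _ C∈rᵢₗ
  ...       | j , _ , refl = inj₁ (r-exclusion-satisfied j (∈others⇒≢ i l l∈))
  initial-cases C∈ | inj₂ _ | inj₂ _ | inj₂ C∈₃
    with ∈-++⁻ (map (λ i → pos (v i) ∷ map (λ l → pos (s i l)) (allFin H)) (allFin n)) C∈₃
  ... | inj₁ C∈s with ∈-map⁻ _ C∈s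
  ...   | i , _ , refl = inj₂ (i , refl)
  initial-cases C∈ | inj₂ _ | inj₂ _ | inj₂ _ | inj₂ C∈s
    with find (∈-concatMap⁻ _ {xs = allFin n} C∈s)
  ... | i , _ , C∈sᵢ with find (∈-concatMap⁻ _ {xs = others i} C∈sᵢ)
  ...   | l , l∈ , C∈sᵢₗ with ∈-map⁻ _ C∈sᵢₗ
  ...     | j , _ , refl = inj₁ (s-exclusion-satisfied j (∈others⇒≢ i l l∈))

  initial-unique : ∀ {C} π π₁ → C ∈ Ψ′ n k →
    Falsified (occupancy π) C → Falsified (occupancy π₁) C → π ⟨$⟩ʳ zero ≡ π₁ ⟨$⟩ʳ zero
  initial-unique π π₁ C∈ fals fals₁ with initial-cases C∈
  ... | inj₁ satisfied  = contradiction (λ {l} → fals {l}) (satisfied (occupancy π))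
  ... | inj₂ (i , refl) = pigeon-injective
    (trans (falsified-s-clause π i fals) (sym (falsified-s-clause π₁ i fals₁)))

  falsified-resp-≈ : ∀ {g C D} → C ≈ D → Falsified g C → Falsified g D
  falsified-resp-≈ C≈D fals l∈D = fals (Equivalence.from C≈D l∈D)

  module _ (ρ : Refutation (Ψ′ n k)) where
    open Refutation ρ using (size; label; Edge; acyclic; sinkEmpty)

    -- The inference is a variable so that it can be matched on; `edge` links its predecessors to
    -- the graph. In a resolution step the value of the resolved variable selects the falsified
    -- premise.
    falsified-inference : ∀ u (inf : Inference (Ψ′ n k) label (label u)) →
      (∀ {a} → a ∈ predecessors inf → Edge a u) →
      (∀ {π π₁} → Falsified (occupancy π) (label u) → Falsified (occupancy π₁) (label u) →
        π ⟨$⟩ʳ zero ≡ π₁ ⟨$⟩ʳ zero) ⊎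
      (∃₂ λ a b → TransClosure Edge a u × TransClosure Edge b u ×
        ∀ {π} → Falsified (occupancy π) (label u) →
        Falsified (occupancy π) (label a) ⊎ Falsified (occupancy π) (label b))
    falsified-inference u (initial C C∈ E≈C) edge = inj₁ λ {π} {π₁} fals fals₁ →
      initial-unique π π₁ C∈ (falsified-resp-≈ E≈C fals) (falsified-resp-≈ E≈C fals₁)
    falsified-inference u (weakening a P l a≈P E≈P∨l) edge =
      inj₂ (a , a , [ edge (here refl) ] , [ edge (here refl) ] , λ fals →
        inj₁ λ l∈a → falsified-resp-≈ E≈P∨l fals (∈-++⁺ˡ (Equivalence.to a≈P l∈a)))
    falsified-inference u (resolution a b P Q x a≈ b≈ E≈) edge =
      inj₂ (a , b , [ edge (here refl) ] , [ edge (there (here refl)) ] , λ {π} fals →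
        step (occupancy π) (falsified-resp-≈ E≈ fals))
      where
      step : ∀ g → Falsified g (P ++ Q) → Falsified g (label a) ⊎ Falsified g (label b)
      step g fals with holds? g x
      ... | yes x-true = inj₂ λ l∈b → falsified-b (∈-++⁻ Q (Equivalence.to b≈ l∈b))
        where
        falsified-b : ∀ {l} → l ∈ Q ⊎ l ∈ neg x ∷ [] → ¬ LitHolds g l
        falsified-b (inj₁ l∈Q)         = fals (∈-++⁺ʳ P l∈Q)
        falsified-b (inj₂ (here refl)) = λ x-false → x-false x-true
      ... | no x-false = inj₁ λ l∈a → falsified-a (∈-++⁻ P (Equivalence.to a≈ l∈a))
        where
        falsified-a : ∀ {l} → l ∈ P ⊎ l ∈ pos x ∷ [] → ¬ LitHolds g l
        falsified-a (inj₁ l∈P)         = fals (∈-++⁺ˡ l∈P)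
        falsified-a (inj₂ (here refl)) = x-false

    derivation : Derivation H size
    derivation = record
      { alive              = λ _ → true
      ; forced             = λ u p h → does (forcedBy? (label u) p h)
      ; Falsifies          = λ π u → Falsified (occupancy π) (label u)
      ; falsified⇒alive    = λ _ → refl
      ; falsified⇒unforced = λ fals → falsified⇒unforcedBy fals
      ; falsifies-update   = λ fals same → falsified-update fals same
      ; _≺_                = TransClosure Edge
      ; ≺-wellFounded      = acyclic⇒wellFounded acyclic
      ; inference          = λ u → falsified-inference u (Refutation.inference ρ u) id
      ; sink               = Refutation.sink ρ
      ; sink-falsified     = λ π → falsified-resp-≈ (λ {l} → ⇔-sym (sinkEmpty {l})) λ ()
      }

-- Refuting the polynomial bound.

no-polynomial-bound : ∀ a K c → ¬ (∀ n → 2 ∣ n → suc (a * 2) < n →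
  Σ[ ρ ∈ Refutation (Ψ′ n (suc (a * 2))) ] Refutation.size ρ ≤ K * n ^ c)
no-polynomial-bound a K c refutation = refute (size-bound-fails K c (a * 2))
  where
  open ≤-Reasoning
  k = suc (a * 2)

  refute : ¬ (∃ λ q → 2 ≤ q × 35 ^ (3 * q) * (K * (a * 2 + 6 * q) ^ c) < 36 ^ (3 * q))
  refute (q , 2≤q , few) = <⇒≱ few (begin
    36 ^ (3 * q)                           ≤⟨ derivation-size q 2≤q 1+H≡6q (derivation ρ) ⟩
    35 ^ (3 * q) * Refutation.size ρ       ≤⟨ *-monoʳ-≤ (35 ^ (3 * q)) size≤ ⟩
    35 ^ (3 * q) * (K * n ^ c)             ∎)
    where
    -- This even `n` leaves exactly `6 * q` false variables as pigeons.
    n = a * 2 + 6 * q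

    2∣n : 2 ∣ n
    2∣n = divides (a + 3 * q) (halve a q)
      where
      halve : ∀ a q → a * 2 + 6 * q ≡ (a + 3 * q) * 2
      halve = solve-∀

    k<n : k < n
    k<n = begin-strict
      suc (a * 2)  <⟨ n<1+n _ ⟩
      2 + a * 2    ≡⟨ +-comm 2 (a * 2) ⟩
      a * 2 + 2    ≤⟨ +-monoʳ-≤ (a * 2) (≤-trans 2≤q (m≤n*m q 6)) ⟩
      n            ∎

    n≡2a+1+H : a * 2 + suc (n ∸ k) ≡ n
    n≡2a+1+H = trans (+-suc (a * 2) (n ∸ k)) (m+[n∸m]≡n (<⇒≤ k<n))

    1+H≡6q : suc (n ∸ k) ≡ 6 * q
    1+H≡6q = +-cancelˡ-≡ (a * 2) _ _ n≡2a+1+H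

    open CriticalAssignments a n n≡2a+1+H

    ρ     = proj₁ (refutation n 2∣n k<n)
    size≤ = proj₂ (refutation n 2∣n k<n)

lemma5 : (k : ℕ) → 2 ∤ k →
    ¬ (Σ[ f ∈ (ℕ → ℕ) ] Σ[ c ∈ ℕ ] (0 < c × ((n : ℕ) → 2 ∣ n → k < n →
    Σ[ π ∈ Refutation (Ψ′ n k) ] (Refutation.size π ≤ f k * n ^ c))))
lemma5 k 2∤k (f , c , _ , refutation) with odd-form k 2∤k
-- For fixed `k` the factor `f k` is a constant.
... | a , refl = no-polynomial-bound a (f k) c refutation
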